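{- Let $T$ be a Boolean algebra (with order $\le$, meet $\land$, join $\lor$ and complement $\neg$), and let $(a,g)$ and $(a',g')$ be contracts over $T$. Let $\mathcal{C}_c=(a_c,g_c)$ be their composition, given by $$a_c=(a\land a')\lor(a\land\neg g)\lor(a'\land\neg g'),\qquad g_c=(g\lor\neg a)\land(g'\lor\neg a').$$ Suppose that $a''\in T$ satisfies $a''\land g\land a\le a'\land g\land a$ and that $g''\in T$ satisfies $g\land g'\le g''$. Then the contract $(a\land a'',\,g'')$ is a relaxation of $\mathcal{C}_c$, i.e. $\mathcal{C}_c\le (a\land a'',g'')$.
   Context: A contract over a Boolean algebra $T$ (the "term algebra") is a pair $(a,g)$ of elements of $T$, called assumptions and guarantees. Contracts are ordered by refinement: for contracts $\mathcal{C}=(a,g)$ and $\mathcal{C}'=(a',g')$, $\mathcal{C}\le\mathcal{C}'$ (read "$\mathcal{C}$ refines $\mathcal{C}'$", or "$\mathcal{C}'$ is a relaxation of $\mathcal{C}$") holds iff $a'\le a$ and $g\lor\neg a\le g'\lor\neg a'$. -}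

module Defs where

open import Data.Product using (_×_)
open import Relation.Binary using (Rel)
open import Relation.Binary.Lattice using (BooleanAlgebra)

module Contracts {c ℓ₁ ℓ₂} (T : BooleanAlgebra c ℓ₁ ℓ₂) where

  open BooleanAlgebra T

  infix  4 _≼_
  infixr 7 _∥_

  record Contract : Set c where
    constructor ⟨_,_⟩
    field
      assumptions : Carrier
      guarantees  : Carrier

  -- Refinement; the coarser contract, i.e. the relaxation, is on the right.
  _≼_ : Rel Contract ℓ₂
  ⟨ a , g ⟩ ≼ ⟨ a′ , g′ ⟩ = (a′ ≤ a) × (g ∨ ¬ a ≤ g′ ∨ ¬ a′)

  _∥_ : Contract → Contract → Contract
  ⟨ a , g ⟩ ∥ ⟨ a′ , g′ ⟩ =
    ⟨ (a ∧ a′) ∨ (a ∧ ¬ g) ∨ (a′ ∧ ¬ g′)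
    , (g ∨ ¬ a) ∧ (g′ ∨ ¬ a′)
    ⟩

{-# OPTIONS --safe #-}
-- Below z = a ∧ a″, splitting on g gives z ≤ a_c: the part below g lies in
-- a ∧ a′ by the hypothesis on a″, the rest in a ∧ ¬ g.  For the guarantees it
-- suffices that g_c ∧ z and ¬ a_c ∧ z lie below g″.  The latter is ⊥; in the
-- former, a yields g, then g yields a′ (hypothesis on a″), and a′ yields g′.
module Submission where

open import Defs
open import Data.Product using (_,_)
open import Relation.Binary.Lattice using (BooleanAlgebra)
import Relation.Binary.Lattice.Properties.HeytingAlgebra as HeytingProperties
import Relation.Binary.Lattice.Properties.JoinSemilattice as JoinProperties
import Relation.Binary.Lattice.Properties.MeetSemilattice as MeetProperties

module BooleanReasoning {c ℓ₁ ℓ₂} (T : BooleanAlgebra c ℓ₁ ℓ₂) where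

  open BooleanAlgebra T
  open HeytingProperties heytingAlgebra using (∧-distribˡ-∨-≤)
  open JoinProperties joinSemilattice using (∨-comm)
  open MeetProperties meetSemilattice using (∧-monotonic)

  -- The Heyting implication `y ⇨ x` is by definition `¬ y ∨ x`, so this is one half of residuation
  -- up to commuting the join; `modus-ponens` rests on the other half.
  discharge : ∀ {w x y} → w ∧ y ≤ x → w ≤ x ∨ ¬ y
  discharge w∧y≤x = trans (transpose-⇨ w∧y≤x) (reflexive (∨-comm _ _))

  modus-ponens : ∀ {w x y} → w ≤ x ∨ ¬ y → w ≤ y → w ≤ x
  modus-ponens w≤x∨¬y w≤y =
    trans (∧-greatest refl w≤y)
          (transpose-∧ (trans w≤x∨¬y (reflexive (∨-comm _ _))))

  -- The first case discharges to `w ≤ x ∨ ¬ y`; meeting with `w` and distributing leaves `w ∧ x`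
  -- and the second case.
  by-cases : ∀ {w x} y → w ∧ y ≤ x → w ∧ ¬ y ≤ x → w ≤ x
  by-cases y w∧y≤x w∧¬y≤x =
    trans (∧-greatest refl (discharge w∧y≤x))
          (trans (∧-distribˡ-∨-≤ _ _ _) (∨-least (x∧y≤y _ _) w∧¬y≤x))

  -- Ex falso: `¬ x ≤ ¬ x ∨ z`, which is `x ⇨ z`, so `¬ x ∧ x ≤ z` by residuation.
  ¬x∧y≤z : ∀ {x y z} → y ≤ x → ¬ x ∧ y ≤ z
  ¬x∧y≤z y≤x = trans (∧-monotonic refl y≤x) (transpose-∧ (x≤x∨y _ _))

theorem1 : ∀ {c ℓ₁ ℓ₂} (T : BooleanAlgebra c ℓ₁ ℓ₂) →
    let open BooleanAlgebra T
        open Contracts T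
    in
    (a g a′ g′ a″ g″ : Carrier) →
    a″ ∧ g ∧ a ≤ a′ ∧ g ∧ a →
    g ∧ g′ ≤ g″ →
    ⟨ a , g ⟩ ∥ ⟨ a′ , g′ ⟩ ≼ ⟨ a ∧ a″ , g″ ⟩
theorem1 T a g a′ g′ a″ g″ a″ga≤a′ga gg′≤g″ =
  z≤a-c , ∨-least (discharge g-c∧z≤g″) (discharge (¬x∧y≤z z≤a-c))
  where
  open BooleanAlgebra T
  open BooleanReasoning T
  open MeetProperties meetSemilattice using (∧-monotonic)

  z a-c g-c : Carrier
  z   = a ∧ a″
  a-c = (a ∧ a′) ∨ (a ∧ ¬ g) ∨ (a′ ∧ ¬ g′)
  g-c = (g ∨ ¬ a) ∧ (g′ ∨ ¬ a′)

  -- Kept general in `w` to serve both halves of refinement: `w = z ∧ g` for the assumptions and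
  -- `w = g-c ∧ z` for the guarantees.
  below-a′ : ∀ {w} → w ≤ z → w ≤ g → w ≤ a′
  below-a′ w≤z w≤g =
    trans (∧-greatest (trans w≤z (x∧y≤y _ _))
                      (∧-greatest w≤g (trans w≤z (x∧y≤x _ _))))
          (trans a″ga≤a′ga (x∧y≤x _ _))

  z≤a-c : z ≤ a-c
  z≤a-c = by-cases g
    (trans (∧-greatest (trans (x∧y≤x _ _) (x∧y≤x _ _))
                       (below-a′ (x∧y≤x _ _) (x∧y≤y _ _)))
           (x≤x∨y _ _))
    (trans (∧-monotonic (x∧y≤x _ _) refl)
           (trans (x≤x∨y _ _) (y≤x∨y _ _)))

  g-c∧z≤g : g-c ∧ z ≤ g
  g-c∧z≤g = modus-ponens (trans (x∧y≤x _ _) (x∧y≤x _ _))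
                         (trans (x∧y≤y _ _) (x∧y≤x _ _))

  g-c∧z≤g′ : g-c ∧ z ≤ g′
  g-c∧z≤g′ = modus-ponens (trans (x∧y≤x _ _) (x∧y≤y _ _))
                          (below-a′ (x∧y≤y _ _) g-c∧z≤g)

  g-c∧z≤g″ : g-c ∧ z ≤ g″
  g-c∧z≤g″ = trans (∧-greatest g-c∧z≤g g-c∧z≤g′) gg′≤g″
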